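{- Let $n\geq 3$ and $\ell\geq 2$ be integers. Then $$pc_{1,\ell}(W_n)=\begin{cases} 1 & \text{if } n=3,\\ 2 & \text{if } 4\leq n\leq 6,\\ 3 & \text{otherwise.}\end{cases}$$
   Context: The wheel $W_n$ is the graph on $n+1$ vertices obtained from the cycle $C_n$ by joining a new vertex to all vertices of $C_n$. An edge-coloring of a graph is an arbitrary map from its edge set to the natural numbers (adjacent edges may share a color). In an edge-colored graph, a path $P$ is a distance $\ell$-proper path if no two edges of $P$ of the same color appear with fewer than $\ell$ edges in between on $P$. For a connected graph $G$, $pc_{1,\ell}(G)$ is the minimum number of colors in an edge-coloring of $G$ such that every pair of distinct vertices of $G$ is connected by at least one distance $\ell$-proper path. -}

module Defs where

open import Data.Empty using (⊥)
open import Data.Fin using (Fin; zero; suc; toℕ) renaming (_<_ to _<ᶠ_)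
open import Data.List using (List; []; _∷_; length; lookup)
open import Data.List.Membership.Propositional using (_∈_)
open import Data.List.Relation.Unary.Unique.Propositional using (Unique)
open import Data.Nat using (ℕ; suc; _∸_; _≤_; _≮_; s≤s)
open import Data.Nat.Properties using (1+n≢n)
open import Data.Product using (∃; ∃-syntax; _×_; _,_)
open import Data.Sum using (_⊎_; inj₁; inj₂; swap)
open import Data.Unit using (⊤; tt)
open import Function.Bundles using (_⇔_)
open import Relation.Binary.PropositionalEquality using (_≡_; _≢_; refl; sym; trans; cong)
open import Relation.Nullary using (¬_)

record Graph (m : ℕ) : Set₁ where
  field
    Adj       : Fin m → Fin m → Set
    symmetric : ∀ {u v} → Adj u v → Adj v u
    loopless  : ∀ {u} → ¬ Adj u u

open Graph public

-- Cyclic successor on 0, …, n-1.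
Next : ∀ {n} → Fin n → Fin n → Set
Next {n} i j = (suc (toℕ i) ≡ toℕ j) ⊎ (suc (toℕ i) ≡ n × toℕ j ≡ 0)

Next-irreflexive : ∀ {n} → 3 ≤ n → {i : Fin n} → ¬ Next i i
Next-irreflexive _ (inj₁ e) = 1+n≢n e
Next-irreflexive 3≤n (inj₂ (e , z)) with trans (sym e) (cong suc z)
Next-irreflexive (s≤s ()) (inj₂ (e , z)) | refl

cycle : (n : ℕ) → 3 ≤ n → Graph n
cycle n 3≤n = record
  { Adj       = λ i j → Next i j ⊎ Next j i
  ; symmetric = swap
  ; loopless  = λ { (inj₁ p) → Next-irreflexive 3≤n p
                  ; (inj₂ p) → Next-irreflexive 3≤n p }
  }

-- Adds a new vertex `zero` joined to every vertex of G; the vertex v of G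
-- becomes `suc v`.
cone : ∀ {m} → Graph m → Graph (suc m)
cone {m} G = record { Adj = A ; symmetric = λ {u} {v} → A-sym u v ; loopless = λ {u} → A-irr u }
  where
  A : Fin (suc m) → Fin (suc m) → Set
  A zero    zero    = ⊥
  A zero    (suc _) = ⊤
  A (suc _) zero    = ⊤
  A (suc u) (suc v) = Adj G u v

  A-sym : ∀ u v → A u v → A v u
  A-sym zero    (suc _) _ = tt
  A-sym (suc _) zero    _ = tt
  A-sym (suc _) (suc _) p = symmetric G p

  A-irr : ∀ u → ¬ A u u
  A-irr (suc _) p = loopless G p

wheel : (n : ℕ) → 3 ≤ n → Graph (suc n)
wheel n 3≤n = cone (cycle n 3≤n)

-- A function on the set of undirected edges: `undirected` makes the colour
-- independent both of the orientation of the edge and of the adjacency proof.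
record EdgeColouring {m : ℕ} (G : Graph m) : Set where
  field
    colour     : ∀ {u v} → Adj G u v → ℕ
    undirected : ∀ {u v} (p : Adj G u v) (q : Adj G v u) → colour p ≡ colour q

open EdgeColouring public

-- The image of the colouring has exactly k elements.
UsesColours : ∀ {m} {G : Graph m} → EdgeColouring G → ℕ → Set
UsesColours {G = G} c k =
  ∃[ cs ] length cs ≡ k × Unique cs ×
    (∀ a → a ∈ cs ⇔ (∃[ u ] ∃[ v ] ∃[ p ] colour c {u} {v} p ≡ a))

infixr 5 _∷_

data Walk {m : ℕ} (G : Graph m) : Fin m → Fin m → Set where
  []  : ∀ {u} → Walk G u u
  _∷_ : ∀ {u v w} → Adj G u v → Walk G v w → Walk G u w

vertices : ∀ {m} {G : Graph m} {u v} → Walk G u v → List (Fin m)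
vertices {u = u} []      = u ∷ []
vertices {u = u} (_ ∷ w) = u ∷ vertices w

IsPath : ∀ {m} {G : Graph m} {u v} → Walk G u v → Set
IsPath w = Unique (vertices w)

colours : ∀ {m} {G : Graph m} → EdgeColouring G → ∀ {u v} → Walk G u v → List ℕ
colours c []      = []
colours c (p ∷ w) = colour c p ∷ colours c w

-- Between the entries at positions i < j there are j - i - 1 others.
DistanceProper : ℕ → List ℕ → Set
DistanceProper ℓ cs =
  ∀ (i j : Fin (length cs)) → i <ᶠ j → lookup cs i ≡ lookup cs j →
    toℕ j ∸ suc (toℕ i) ≮ ℓ

DistanceProperConnected : ∀ {m} {G : Graph m} → ℕ → EdgeColouring G → Set
DistanceProperConnected {G = G} ℓ c =
  ∀ u v → u ≢ v → ∃[ w ] IsPath {G = G} {u} {v} w × DistanceProper ℓ (colours c w)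

IsMinimum : (ℕ → Set) → ℕ → Set
IsMinimum P k = P k × (∀ j → P j → k ≤ j)

-- IsPc₁ G ℓ k says that pc_{1,ℓ}(G) exists and equals k; if G is disconnected,
-- this holds for no k.
IsPc₁ : ∀ {m} → Graph m → ℕ → ℕ → Set
IsPc₁ G ℓ k =
  IsMinimum (λ j → ∃[ c ] UsesColours {G = G} c j × DistanceProperConnected ℓ c) k

{-# OPTIONS --safe #-}

-- With two colours a distance ℓ-proper path (ℓ ≥ 2) has at most two edges, since
-- any three consecutive edges have distinct colours. Rim vertices at cyclic
-- distance at least 3 are then only connected through the hub, so their spokes
-- differ in colour; for n ≥ 7 the graph of such pairs contains an odd cycle, so
-- two colours do not suffice. For 4 ≤ n ≤ 6, colouring spokes by ⌊i/3⌋ and rim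
-- edges alternately does; for n = 3 all vertices are adjacent. Three colours
-- always suffice: alternate the colours of the spokes and give the rim the third
-- one.
module Submission where

open import Data.Bool using (if_then_else_; _∧_)
open import Data.Fin using (Fin; zero; suc; toℕ; inject₁; #_) renaming (_<_ to _<ᶠ_)
open import Data.Fin.Properties using (<-cmp; any?; all?; injective⇒≤; toℕ-inject₁; toℕ<n)
  renaming (_≟_ to _≟ᶠ_; suc-injective to sucᶠ-injective)
open import Data.List using (List; []; _∷_; length; lookup; upTo)
open import Data.List.Membership.Propositional using (_∈_)
open import Data.List.Membership.Propositional.Properties using (∈-lookup; ∈-upTo⁺; ∈-upTo⁻)
open import Data.List.Membership.Setoid.Properties using (index-injective)
open import Data.List.Properties using (length-upTo)
open import Data.List.Relation.Unary.All as All using (All; []; _∷_)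
open import Data.List.Relation.Unary.AllPairs using ([]; _∷_)
open import Data.List.Relation.Unary.Any using (index)
open import Data.List.Relation.Unary.Unique.Propositional using (Unique)
open import Data.List.Relation.Unary.Unique.Propositional.Properties using (upTo⁺)
open import Data.Nat
  using (ℕ; zero; suc; _+_; _≤_; _<_; _≡ᵇ_; _≤ᵇ_; _/_; _%_; _⊓_; z≤n; s≤s; s<s⁻¹)
open import Data.Nat.DivMod using (m%n<n)
open import Data.Nat.Properties
  using (_≤?_; _<?_; ≤-reflexive; ≤-trans; <⇒≤; <⇒≢; <⇒≱; ≮⇒≥; m≤m+n; m+n≮n; n≤1+n; n<1+n;
         m≤n⇒m≤1+n; m<n⇒m<1+n; +-comm; +-identityʳ; +-mono-≤; ⊓-comm; module ≤-Reasoning)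
  renaming (_≟_ to _≟ⁿ_)
open import Data.Product using (∃-syntax; _×_; _,_)
open import Data.Sum using (_⊎_; inj₁; inj₂)
open import Data.Unit using (tt)
open import Function using (_∘_)
open import Function.Bundles using (Equivalence; mk⇔)
open import Relation.Binary.Definitions using (tri<; tri≈; tri>)
open import Relation.Binary.PropositionalEquality
  using (_≡_; _≢_; refl; sym; trans; cong; subst; setoid; ≢-sym)
open import Relation.Nullary using (¬_; Dec; yes; no; contradiction)
open import Relation.Nullary.Decidable
  using (True; toWitness; decidable-stable; ¬?; _×-dec_; _⊎-dec_; from-yes)

open import Defs

private
  variable
    m : ℕ
    G : Graph m

-- Unique lists

lookup-unique : ∀ {a} {A : Set a} {xs : List A} → Unique xs →
  ∀ {i j} → i <ᶠ j → lookup xs i ≢ lookup xs j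
lookup-unique (x∉xs ∷ _)  {zero}  {suc j} _   = All.lookup x∉xs (∈-lookup j)
lookup-unique (_ ∷ xs!)   {suc i} {suc j} i<j = lookup-unique xs! (s<s⁻¹ i<j)

lookup-unique-injective : ∀ {a} {A : Set a} {xs : List A} → Unique xs →
  ∀ {i j} → lookup xs i ≡ lookup xs j → i ≡ j
lookup-unique-injective xs! {i} {j} eq with <-cmp i j
... | tri< i<j _ _ = contradiction eq (lookup-unique xs! i<j)
... | tri≈ _ i≡j _ = i≡j
... | tri> _ _ j<i = contradiction (sym eq) (lookup-unique xs! j<i)

-- Pigeonhole: sending a position of `xs` to the position of its entry in `ys` is injective.
unique-length-≤ : ∀ {a} {A : Set a} {xs ys : List A} → Unique xs → All (_∈ ys) xs →
  length xs ≤ length ys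
unique-length-≤ {A = A} xs! xs⊆ys = injective⇒≤ {f = λ i → index (All.lookup xs⊆ys (∈-lookup i))}
  (lookup-unique-injective xs! ∘ index-injective (setoid A) _ _)

unique₂ : ∀ {a} {A : Set a} {x y : A} → x ≢ y → Unique (x ∷ y ∷ [])
unique₂ x≢y = (x≢y ∷ []) ∷ [] ∷ []

unique₃ : ∀ {a} {A : Set a} {x y z : A} → x ≢ y → x ≢ z → y ≢ z → Unique (x ∷ y ∷ z ∷ [])
unique₃ x≢y x≢z y≢z = (x≢y ∷ x≢z ∷ []) ∷ unique₂ y≢z

-- Colours in use

Occurs : EdgeColouring G → ℕ → Set
Occurs c a = ∃[ u ] ∃[ v ] ∃[ p ] colour c {u} {v} p ≡ a

occurs : (c : EdgeColouring G) → ∀ {u v} (p : Adj G u v) → Occurs c (colour c p)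
occurs c p = _ , _ , p , refl

-- Every lower bound on the number of colours goes through this, by exhibiting distinct colours that
-- occur.
distinct-colours-≤ : ∀ {k xs} (c : EdgeColouring G) → UsesColours c k →
  Unique xs → All (Occurs c) xs → length xs ≤ k
distinct-colours-≤ c (cs , refl , _ , used) xs! occ =
  unique-length-≤ xs! (All.map (λ {a} → Equivalence.from (used a)) occ)

usesColours-< : ∀ {k} (c : EdgeColouring G) →
  (∀ u v (p : Adj G u v) → colour c p < k) → (∀ {a} → a < k → Occurs c a) →
  UsesColours c k
usesColours-< {k = k} c bound attained = upTo k , length-upTo k , upTo⁺ k , λ a →
  mk⇔ (attained ∘ ∈-upTo⁻) λ { (u , v , p , refl) → ∈-upTo⁺ (bound u v p) }

fromSymmetric : ∀ {m} {G : Graph m} (h : Fin m → Fin m → ℕ) → (∀ u v → h u v ≡ h v u) → EdgeColouring G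
fromSymmetric h h-sym = record
  { colour     = λ {u} {v} _ → h u v
  ; undirected = λ {u} {v} _ _ → h-sym u v
  }

-- Distance-proper paths

Connected : ∀ {m} {G : Graph m} → ℕ → EdgeColouring G → Fin m → Fin m → Set
Connected {G = G} ℓ c u v = ∃[ w ] IsPath {G = G} {u} {v} w × DistanceProper ℓ (colours c w)

-- The paths built for the upper bounds repeat no colour, so they serve every `ℓ` at once.
rainbow⇒distanceProper : ∀ {ℓ xs} → Unique xs → DistanceProper ℓ xs
rainbow⇒distanceProper xs! _ _ i<j eq = contradiction eq (lookup-unique xs! i<j)

adjacent⇒≢ : ∀ {m} (G : Graph m) → ∀ {u v} → Adj G u v → u ≢ v
adjacent⇒≢ G p refl = loopless G p

connected₁ : ∀ {ℓ} (c : EdgeColouring G) → ∀ {u v} → Adj G u v → Connected ℓ c u v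
connected₁ {G = G} c p =
  p ∷ [] , unique₂ (adjacent⇒≢ G p) , rainbow⇒distanceProper ([] ∷ [])

connected₂ : ∀ {ℓ} (c : EdgeColouring G) → ∀ {u v x} → u ≢ v →
  (p : Adj G u x) (q : Adj G x v) → colour c p ≢ colour c q → Connected ℓ c u v
connected₂ {G = G} c u≢v p q cp≢cq =
  p ∷ q ∷ [] , unique₃ (adjacent⇒≢ G p) u≢v (adjacent⇒≢ G q) , rainbow⇒distanceProper (unique₂ cp≢cq)

connected₃ : ∀ {ℓ} (c : EdgeColouring G) → ∀ {u v x y} → u ≢ v → u ≢ y → x ≢ v →
  (p : Adj G u x) (q : Adj G x y) (r : Adj G y v) →
  Unique (colour c p ∷ colour c q ∷ colour c r ∷ []) → Connected ℓ c u v
connected₃ {G = G} c u≢v u≢y x≢v p q r pqr! =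
  p ∷ q ∷ r ∷ [] ,
  (adjacent⇒≢ G p ∷ u≢y ∷ u≢v ∷ []) ∷ unique₃ (adjacent⇒≢ G q) x≢v (adjacent⇒≢ G r) ,
  rainbow⇒distanceProper pqr!

first-two-differ : ∀ {ℓ x y xs} → 2 ≤ ℓ → DistanceProper ℓ (x ∷ y ∷ xs) → x ≢ y
first-two-differ 2≤ℓ dp x≡y = dp zero (# 1) (s≤s z≤n) x≡y (≤-trans (s≤s z≤n) 2≤ℓ)

first-three-differ : ∀ {ℓ x y z xs} → 2 ≤ ℓ → DistanceProper ℓ (x ∷ y ∷ z ∷ xs) →
  Unique (x ∷ y ∷ z ∷ [])
first-three-differ 2≤ℓ dp = unique₃
  (first-two-differ 2≤ℓ dp)
  -- Exactly one edge lies between positions 0 and 2, and `1 < ℓ` unfolds to `2≤ℓ`.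
  (λ x≡z → dp zero (# 2) (s≤s z≤n) x≡z 2≤ℓ)
  (λ y≡z → dp (# 1) (# 2) (s≤s (s≤s z≤n)) y≡z (≤-trans (s≤s z≤n) 2≤ℓ))

TwoColouredPath : ∀ {m} {G : Graph m} → EdgeColouring G → Fin m → Fin m → Set
TwoColouredPath {G = G} c u v =
  ∃[ x ] ∃[ p ] ∃[ q ] colour c {u} {x} p ≢ colour c {x} {v} q

-- Sorts the path by length: one edge, two edges, or at least three, where the first three edges
-- already show three colours.
connected⇒short : ∀ {ℓ k} (c : EdgeColouring G) → 2 ≤ ℓ → UsesColours c k →
  ∀ {u v} → u ≢ v → Connected ℓ c u v →
  Adj G u v ⊎ TwoColouredPath c u v ⊎ 3 ≤ k
connected⇒short c 2≤ℓ uses u≢v ([] , _)         = contradiction refl u≢v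
connected⇒short c 2≤ℓ uses u≢v (p ∷ [] , _)     = inj₁ p
connected⇒short c 2≤ℓ uses u≢v (p ∷ q ∷ [] , _ , dp) =
  inj₂ (inj₁ (_ , p , q , first-two-differ 2≤ℓ dp))
connected⇒short c 2≤ℓ uses u≢v (p ∷ q ∷ r ∷ _ , _ , dp) =
  inj₂ (inj₂ (distinct-colours-≤ c uses (first-three-differ 2≤ℓ dp)
    (occurs c p ∷ occurs c q ∷ occurs c r ∷ [])))

nonadjacent⇒2≤ : ∀ {ℓ k} (c : EdgeColouring G) → 2 ≤ ℓ → UsesColours c k →
  DistanceProperConnected ℓ c → ∀ {u v} → u ≢ v → ¬ Adj G u v → 2 ≤ k
nonadjacent⇒2≤ c 2≤ℓ uses conn u≢v ¬uv with connected⇒short c 2≤ℓ uses u≢v (conn _ _ u≢v)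
... | inj₁ uv = contradiction uv ¬uv
... | inj₂ (inj₁ (_ , p , q , cp≢cq)) =
  distinct-colours-≤ c uses (unique₂ cp≢cq) (occurs c p ∷ occurs c q ∷ [])
... | inj₂ (inj₂ 3≤k) = ≤-trans (s≤s (s≤s z≤n)) 3≤k

-- Cyclic distance at least 3

-- The two conjuncts bound the two arcs between `i` and `j` from below, the second being
-- `3 ≤ n - (j - i)` without subtraction. The order `i < j` is built in, hence the uses of `≢-sym`
-- further on.
Far : ∀ {n} → Fin n → Fin n → Set
Far {n} i j = 3 + toℕ i ≤ toℕ j × 3 + toℕ j ≤ n + toℕ i

RimEdge : ∀ {n} → Fin n → Fin n → Set
RimEdge i j = Next i j ⊎ Next j i

-- Keeps only the inequalities that refute `Far`. Both orientations of a non-closing edge merge into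
-- `near`; the other two constructors describe the closing edge by which end is 0.
data RimEdgeView (n a b : ℕ) : Set where
  near  : b ≤ 1 + a → a ≤ 1 + b → RimEdgeView n a b
  wrapˡ : a ≡ 0 → n ≤ 1 + b → RimEdgeView n a b
  wrapʳ : b ≡ 0 → n ≤ 1 + a → RimEdgeView n a b

1+a≡b⇒a≤1+b : ∀ {a b} → 1 + a ≡ b → a ≤ 1 + b
1+a≡b⇒a≤1+b refl = m≤n⇒m≤1+n (n≤1+n _)

rimEdgeView : ∀ {n} {i j : Fin n} → RimEdge i j → RimEdgeView n (toℕ i) (toℕ j)
rimEdgeView (inj₁ (inj₁ e))       = near (≤-reflexive (sym e)) (1+a≡b⇒a≤1+b e)
rimEdgeView (inj₁ (inj₂ (e , z))) = wrapʳ z (≤-reflexive (sym e))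
rimEdgeView (inj₂ (inj₁ e))       = near (1+a≡b⇒a≤1+b e) (≤-reflexive (sym e))
rimEdgeView (inj₂ (inj₂ (e , z))) = wrapˡ z (≤-reflexive (sym e))

-- A common neighbour would make one of the two arcs only two edges long.
far⇒no-common-neighbour : ∀ {n} {i j k : Fin n} → Far i j → RimEdge i k → ¬ RimEdge k j
far⇒no-common-neighbour {n} {i} {j} {k} (3+i≤j , 3+j≤n+i) ik kj
  with rimEdgeView ik | rimEdgeView kj
-- Here `i` would be the last rim vertex, leaving no room for `j` after it.
... | wrapʳ _ n≤1+i | _ = m+n≮n 1 _ (begin
  2 + (1 + toℕ i)  ≤⟨ 3+i≤j ⟩
  toℕ j            ≤⟨ <⇒≤ (toℕ<n j) ⟩
  n                ≤⟨ n≤1+i ⟩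
  1 + toℕ i        ∎)
  where open ≤-Reasoning
... | _ | wrapʳ j≡0 _ = contradiction (subst (3 + toℕ i ≤_) j≡0 3+i≤j) λ ()
... | near k≤1+i _ | near j≤1+k _ = m+n≮n 0 _ (begin
  3 + toℕ i  ≤⟨ 3+i≤j ⟩
  toℕ j      ≤⟨ j≤1+k ⟩
  1 + toℕ k  ≤⟨ s≤s k≤1+i ⟩
  2 + toℕ i  ∎)
  where open ≤-Reasoning
-- In this case and the next, the arc through the closing edge is too short: `k` is its end 0 here
-- and its end `n - 1` there.
... | near _ i≤1+k | wrapˡ k≡0 n≤1+j = m+n≮n 0 _ (begin
  3 + toℕ j                ≤⟨ 3+j≤n+i ⟩
  n + toℕ i                ≤⟨ +-mono-≤ n≤1+j i≤1+k ⟩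
  1 + toℕ j + suc (toℕ k)  ≡⟨ cong (λ x → 1 + toℕ j + suc x) k≡0 ⟩
  1 + toℕ j + 1            ≡⟨ +-comm _ 1 ⟩
  2 + toℕ j                ∎)
  where open ≤-Reasoning
... | wrapˡ i≡0 n≤1+k | near _ k≤1+j = m+n≮n 0 _ (begin
  3 + toℕ j  ≤⟨ 3+j≤n+i ⟩
  n + toℕ i  ≡⟨ cong (n +_) i≡0 ⟩
  n + 0      ≡⟨ +-identityʳ n ⟩
  n          ≤⟨ n≤1+k ⟩
  1 + toℕ k  ≤⟨ s≤s k≤1+j ⟩
  2 + toℕ j  ∎)
  where open ≤-Reasoning
... | wrapˡ _ n≤1+k | wrapˡ k≡0 _ = m+n≮n 1 _ (begin
  2 + 1      ≤⟨ m≤m+n 3 _ ⟩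
  3 + toℕ i  ≤⟨ 3+i≤j ⟩
  toℕ j      ≤⟨ <⇒≤ (toℕ<n j) ⟩
  n          ≤⟨ n≤1+k ⟩
  1 + toℕ k  ≡⟨ cong suc k≡0 ⟩
  1          ∎)
  where open ≤-Reasoning

far⇒nonadjacent : ∀ {n} {i j : Fin n} → Far i j → ¬ RimEdge i j
far⇒nonadjacent {n} {i} {j} (3+i≤j , 3+j≤n+i) ij with rimEdgeView ij
... | near j≤1+i _ = m+n≮n 1 _ (≤-trans 3+i≤j j≤1+i)
... | wrapʳ j≡0 _  = contradiction (subst (3 + toℕ i ≤_) j≡0 3+i≤j) λ ()
... | wrapˡ i≡0 n≤1+j = m+n≮n 1 _ (begin
  3 + toℕ j  ≤⟨ 3+j≤n+i ⟩
  n + toℕ i  ≡⟨ cong (n +_) i≡0 ⟩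
  n + 0      ≡⟨ +-identityʳ n ⟩
  n          ≤⟨ n≤1+j ⟩
  1 + toℕ j  ∎)
  where open ≤-Reasoning

far⇒≢ : ∀ {n} {i j : Fin n} → Far i j → i ≢ j
far⇒≢ (3+i≤i , _) refl = m+n≮n 2 _ 3+i≤i

far? : ∀ {n} (i j : Fin n) → Dec (Far i j)
far? i j = (_ ≤? _) ×-dec (_ ≤? _)

-- Spokes under fewer than three colours

module FewerThanThreeColours {n} (3≤n : 3 ≤ n) {ℓ k} (c : EdgeColouring (wheel n 3≤n))
  (2≤ℓ : 2 ≤ ℓ) (uses : UsesColours c k) (conn : DistanceProperConnected ℓ c) (k<3 : k < 3) where

  spoke : Fin n → ℕ
  spoke i = colour c {zero} {suc i} tt

  spoke-occurs : ∀ i → Occurs c (spoke i)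
  spoke-occurs i = occurs c {zero} {suc i} tt

  -- Only the two-edge path through the hub remains, and it consists of the two spokes.
  far⇒spokes-differ : ∀ {i j} → Far i j → spoke i ≢ spoke j
  far⇒spokes-differ far si≡sj with connected⇒short c 2≤ℓ uses i≢j (conn _ _ i≢j)
    where i≢j = far⇒≢ far ∘ sucᶠ-injective
  ... | inj₁ ij                            = far⇒nonadjacent far ij
  ... | inj₂ (inj₁ (zero , p , _ , cp≢cq)) = cp≢cq (trans (undirected c p tt) si≡sj)
  ... | inj₂ (inj₁ (suc _ , p , q , _))    = far⇒no-common-neighbour far p q
  ... | inj₂ (inj₂ 3≤k)                    = <⇒≱ k<3 3≤k

  -- At numerals the bounds and `Far` are settled by evaluation, even for `n` of the form `9 + n`
  -- with a variable tail.
  differ : ∀ i j {i<n : True (i <? n)} {j<n : True (j <? n)} →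
    let i′ = #_ i {m<n = i<n}; j′ = #_ j {m<n = j<n} in {far : True (far? i′ j′)} → spoke i′ ≢ spoke j′
  differ _ _ {far = far} = far⇒spokes-differ (toWitness far)

  -- With only two colours, two changes cancel. Chained along an odd cycle, this equates the ends of
  -- its closing pair.
  same-spoke : ∀ {h i j} → spoke h ≢ spoke i → spoke i ≢ spoke j → spoke h ≡ spoke j
  same-spoke {h} {i} {j} h≢i i≢j = decidable-stable (spoke h ≟ⁿ spoke j) λ h≢j →
    <⇒≱ k<3 (distinct-colours-≤ c uses (unique₃ h≢i h≢j i≢j)
      (spoke-occurs h ∷ spoke-occurs i ∷ spoke-occurs j ∷ []))

-- The odd cycles 0 3 6 2 5 1 4 for n = 7, 0 3 6 1 5 for n = 8 and 0 3 6 for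
-- n ≥ 9 consist of pairs at cyclic distance at least 3.
2-colours-insufficient : ∀ n {ℓ k} (3≤7+n : 3 ≤ 7 + n) (c : EdgeColouring (wheel (7 + n) 3≤7+n)) →
  2 ≤ ℓ → UsesColours c k → DistanceProperConnected ℓ c → ¬ k < 3
2-colours-insufficient 0 3≤7 c 2≤ℓ uses conn k<3 =
  differ 0 4 (trans (same-spoke (differ 0 3) (differ 3 6))
             (trans (same-spoke (≢-sym (differ 2 6)) (differ 2 5))
                    (same-spoke (≢-sym (differ 1 5)) (differ 1 4))))
  where
  open FewerThanThreeColours 3≤7 c 2≤ℓ uses conn k<3
2-colours-insufficient 1 3≤8 c 2≤ℓ uses conn k<3 =
  differ 0 5 (trans (same-spoke (differ 0 3) (differ 3 6))
                    (same-spoke (≢-sym (differ 1 6)) (differ 1 5)))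
  where
  open FewerThanThreeColours 3≤8 c 2≤ℓ uses conn k<3
2-colours-insufficient (suc (suc n)) 3≤9+n c 2≤ℓ uses conn k<3 =
  differ 0 6 (same-spoke (differ 0 3) (differ 3 6))
  where
  open FewerThanThreeColours 3≤9+n c 2≤ℓ uses conn k<3

-- Colourings of the wheel

rimEdge? : ∀ {n} (i j : Fin n) → Dec (RimEdge i j)
rimEdge? i j = next? i j ⊎-dec next? j i
  where
  next? : ∀ {n} (i j : Fin n) → Dec (Next i j)
  next? i j = (_ ≟ⁿ _) ⊎-dec ((_ ≟ⁿ _) ×-dec (_ ≟ⁿ _))

wheelAdj? : ∀ {n} (3≤n : 3 ≤ n) (u v : Fin (suc n)) → Dec (Adj (wheel n 3≤n) u v)
wheelAdj? _ zero    zero    = no λ ()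
wheelAdj? _ zero    (suc _) = yes tt
wheelAdj? _ (suc _) zero    = yes tt
wheelAdj? _ (suc i) (suc j) = rimEdge? i j

-- The value 0 at the non-edge between the hub and itself is arbitrary.
wheelLabels : ∀ {n} → (Fin n → ℕ) → (Fin n → Fin n → ℕ) → Fin (suc n) → Fin (suc n) → ℕ
wheelLabels spoke rim zero    zero    = 0
wheelLabels spoke rim zero    (suc j) = spoke j
wheelLabels spoke rim (suc i) zero    = spoke i
wheelLabels spoke rim (suc i) (suc j) = rim i j

wheelColouring : ∀ {n} (3≤n : 3 ≤ n) (spoke : Fin n → ℕ) (rim : Fin n → Fin n → ℕ) →
  (∀ i j → rim i j ≡ rim j i) → EdgeColouring (wheel n 3≤n)
wheelColouring _ spoke rim rim-sym = fromSymmetric (wheelLabels spoke rim) λ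
  { zero    zero    → refl
  ; zero    (suc _) → refl
  ; (suc _) zero    → refl
  ; (suc i) (suc j) → rim-sym i j
  }

wheelColouring-< : ∀ {n k} (3≤n : 3 ≤ n) {spoke : Fin n → ℕ} {rim : Fin n → Fin n → ℕ} rim-sym →
  (∀ i → spoke i < k) → (∀ i j → rim i j < k) →
  ∀ u v (p : Adj (wheel n 3≤n) u v) →
  colour (wheelColouring 3≤n spoke rim rim-sym) {u} {v} p < k
wheelColouring-< _ _ spoke< rim< zero    (suc j) _ = spoke< j
wheelColouring-< _ _ spoke< rim< (suc i) zero    _ = spoke< i
wheelColouring-< _ _ spoke< rim< (suc i) (suc j) _ = rim< i j

-- Three colours for every wheel

suc-%2-≢ : ∀ a → suc a % 2 ≢ a % 2
suc-%2-≢ (suc (suc a)) = suc-%2-≢ a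

threeColouring : ∀ {n} (3≤n : 3 ≤ n) → EdgeColouring (wheel n 3≤n)
threeColouring 3≤n = wheelColouring 3≤n (λ i → toℕ i % 2) (λ _ _ → 2) (λ _ _ → refl)

threeColouring-uses-3 : ∀ {n} (3≤n : 3 ≤ n) → UsesColours (threeColouring 3≤n) 3
threeColouring-uses-3 3≤n@(s≤s (s≤s _)) = usesColours-< (threeColouring 3≤n)
  (wheelColouring-< 3≤n (λ _ _ → refl) (λ i → m<n⇒m<1+n (m%n<n (toℕ i) 2)) (λ _ _ → n<1+n 2))
  λ { {0} _ → zero , # 1 , tt , refl
    ; {1} _ → zero , # 2 , tt , refl
    ; {2} _ → # 1 , # 2 , inj₁ (inj₁ refl) , refl
    ; {suc (suc (suc _))} (s≤s (s≤s (s≤s ())))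
    }

rim-neighbour-%2-≢ : ∀ {n} → 3 ≤ n → (j : Fin n) →
  ∃[ x ] RimEdge x j × toℕ x % 2 ≢ toℕ j % 2
-- Vertex 0 takes its successor, since its cyclic predecessor `n - 1` is even for odd `n`.
rim-neighbour-%2-≢ (s≤s (s≤s _)) zero    = # 1 , inj₂ (inj₁ refl) , λ ()
rim-neighbour-%2-≢ _             (suc j) =
  inject₁ j , inj₁ (inj₁ (cong suc (toℕ-inject₁ j))) ,
  λ eq → suc-%2-≢ (toℕ j) (trans (sym eq) (cong (_% 2) (toℕ-inject₁ j)))

-- When `i` and `j` have equal parity, the path goes from `i` to the hub, out to a neighbour `x` of
-- `j` of the other parity, and along the rim to `j`.
threeColouring-connected : ∀ {n ℓ} (3≤n : 3 ≤ n) → DistanceProperConnected ℓ (threeColouring 3≤n)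
threeColouring-connected 3≤n zero    zero    u≢v = contradiction refl u≢v
threeColouring-connected 3≤n zero    (suc _) _   = connected₁ (threeColouring 3≤n) tt
threeColouring-connected 3≤n (suc _) zero    _   = connected₁ (threeColouring 3≤n) tt
threeColouring-connected 3≤n (suc i) (suc j) u≢v
  with toℕ i % 2 ≟ⁿ toℕ j % 2 | rim-neighbour-%2-≢ 3≤n j
... | no  i≢j | _            = connected₂ (threeColouring 3≤n) {x = zero} u≢v tt tt i≢j
... | yes i≡j | x , xj , x≢j =
  connected₃ (threeColouring 3≤n) {x = zero} {y = suc x} u≢v
    (λ { refl → x≢j i≡j }) (λ ()) tt tt xj
    (unique₃ (λ i≡x → x≢j (trans (sym i≡x) i≡j)) (<⇒≢ (m%n<n (toℕ i) 2)) (<⇒≢ (m%n<n (toℕ x) 2)))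

-- Two colours for small wheels

spokeLabel : ∀ {n} → Fin n → ℕ
spokeLabel i = (toℕ i / 3) % 2

rimLabel : ∀ {n} → Fin n → Fin n → ℕ
rimLabel i j = (toℕ i ⊓ toℕ j) % 2

rimLabel-sym : ∀ {n} (i j : Fin n) → rimLabel i j ≡ rimLabel j i
rimLabel-sym i j = cong (_% 2) (⊓-comm (toℕ i) (toℕ j))

-- For `n ≤ 6` the spoke colours split the rim into 0, 1, 2 and the rest. Vertices of different
-- blocks meet through the hub; inside a block of at most three consecutive vertices the rim colours
-- alternate. The closing edge gets colour 0, which may break the alternation harmlessly.
twoColouring : ∀ {n} (3≤n : 3 ≤ n) → EdgeColouring (wheel n 3≤n)
twoColouring 3≤n = wheelColouring 3≤n spokeLabel rimLabel rimLabel-sym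

twoColouring-uses-2 : ∀ {n} (3≤n : 3 ≤ n) → UsesColours (twoColouring 3≤n) 2
twoColouring-uses-2 3≤n@(s≤s (s≤s (s≤s _))) = usesColours-< (twoColouring 3≤n)
  (wheelColouring-< 3≤n rimLabel-sym
    (λ i → m%n<n (toℕ i / 3) 2) (λ i j → m%n<n (toℕ i ⊓ toℕ j) 2))
  λ { {0} _ → # 1 , # 2 , inj₁ (inj₁ refl) , refl
    ; {1} _ → # 2 , # 3 , inj₁ (inj₁ refl) , refl
    ; {suc (suc _)} (s≤s (s≤s ()))
    }

-- Avoids walks and quantifies over one middle vertex, so that for fixed `n` the whole property is
-- decided by a finite check.
ShortlyConnected : ∀ {n} → 3 ≤ n → Fin (suc n) → Fin (suc n) → Set
ShortlyConnected {n} 3≤n u v =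
  u ≡ v ⊎ A u v ⊎ (∃[ x ] A u x × A x v × label u x ≢ label x v)
  where
  A = Adj (wheel n 3≤n)
  label = wheelLabels spokeLabel rimLabel

shortlyConnected? : ∀ {n} (3≤n : 3 ≤ n) → Dec (∀ u v → ShortlyConnected 3≤n u v)
shortlyConnected? 3≤n = all? λ u → all? λ v →
  (u ≟ᶠ v) ⊎-dec A? u v ⊎-dec any? λ x → A? u x ×-dec A? x v ×-dec ¬? (_ ≟ⁿ _)
  where A? = wheelAdj? 3≤n

twoColouring-connected : ∀ {n ℓ} (3≤n : 3 ≤ n) → (∀ u v → ShortlyConnected 3≤n u v) →
  DistanceProperConnected ℓ (twoColouring 3≤n)
twoColouring-connected 3≤n short u v u≢v with short u v
... | inj₁ u≡v                          = contradiction u≡v u≢v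
... | inj₂ (inj₁ uv)                    = connected₁ (twoColouring 3≤n) uv
... | inj₂ (inj₂ (_ , ux , xv , ux≢xv)) = connected₂ (twoColouring 3≤n) u≢v ux xv ux≢xv

2-colours-necessary : ∀ {n ℓ k} (3≤4+n : 3 ≤ 4 + n) (c : EdgeColouring (wheel (4 + n) 3≤4+n)) →
  2 ≤ ℓ → UsesColours c k → DistanceProperConnected ℓ c → 2 ≤ k
2-colours-necessary _ c 2≤ℓ uses conn =
  -- These are the rim vertices 0 and 2, shifted by the hub; for `n = 3` the closing edge would join
  -- them.
  nonadjacent⇒2≤ c 2≤ℓ uses conn {# 1} {# 3} (λ ()) λ
    { (inj₁ (inj₁ ())) ; (inj₁ (inj₂ (_ , ()))) ; (inj₂ (inj₁ ())) ; (inj₂ (inj₂ (() , _))) }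

pc₁-2 : ∀ {n ℓ} (3≤4+n : 3 ≤ 4 + n) → 2 ≤ ℓ → (∀ u v → ShortlyConnected 3≤4+n u v) →
  IsPc₁ (wheel (4 + n) 3≤4+n) ℓ 2
pc₁-2 3≤4+n 2≤ℓ short =
  (twoColouring 3≤4+n , twoColouring-uses-2 3≤4+n , twoColouring-connected 3≤4+n short) ,
  λ { _ (c , uses , conn) → 2-colours-necessary 3≤4+n c 2≤ℓ uses conn }

-- One colour for the complete wheel

oneColouring : ∀ {n} (3≤n : 3 ≤ n) → EdgeColouring (wheel n 3≤n)
oneColouring 3≤n = fromSymmetric (λ _ _ → 0) (λ _ _ → refl)

oneColouring-uses-1 : ∀ {n} (3≤n : 3 ≤ n) → UsesColours (oneColouring 3≤n) 1
oneColouring-uses-1 3≤n@(s≤s _) = usesColours-< (oneColouring 3≤n) (λ _ _ _ → n<1+n 0)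
  λ { {0} _ → zero , # 1 , tt , refl ; {suc _} (s≤s ()) }

wheel₃-complete : (3≤3 : 3 ≤ 3) → ∀ u v → u ≡ v ⊎ Adj (wheel 3 3≤3) u v
wheel₃-complete 3≤3 = from-yes (all? λ u → all? λ v → (u ≟ᶠ v) ⊎-dec wheelAdj? 3≤3 u v)

oneColouring-connected : ∀ {ℓ} (3≤3 : 3 ≤ 3) → DistanceProperConnected ℓ (oneColouring 3≤3)
oneColouring-connected 3≤3 u v u≢v with wheel₃-complete 3≤3 u v
... | inj₁ u≡v = contradiction u≡v u≢v
... | inj₂ uv  = connected₁ (oneColouring 3≤3) uv

1-colour-necessary : ∀ {n k} (3≤n : 3 ≤ n) (c : EdgeColouring (wheel n 3≤n)) →
  UsesColours c k → 1 ≤ k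
1-colour-necessary (s≤s _) c uses =
  distinct-colours-≤ c uses ([] ∷ []) (occurs c {zero} {# 1} tt ∷ [])

theorem2p9 : (n ℓ : ℕ) (3≤n : 3 ≤ n) → 2 ≤ ℓ →
    IsPc₁ (wheel n 3≤n) ℓ
    (if n ≡ᵇ 3 then 1 else (if (4 ≤ᵇ n) ∧ (n ≤ᵇ 6) then 2 else 3))
theorem2p9 1 _ (s≤s ()) _
theorem2p9 2 _ (s≤s (s≤s ())) _
theorem2p9 3 _ 3≤n _ =
  (oneColouring 3≤n , oneColouring-uses-1 3≤n , oneColouring-connected 3≤n) ,
  λ { _ (c , uses , _) → 1-colour-necessary 3≤n c uses }
theorem2p9 4 _ 3≤n 2≤ℓ = pc₁-2 3≤n 2≤ℓ (from-yes (shortlyConnected? 3≤n))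
theorem2p9 5 _ 3≤n 2≤ℓ = pc₁-2 3≤n 2≤ℓ (from-yes (shortlyConnected? 3≤n))
theorem2p9 6 _ 3≤n 2≤ℓ = pc₁-2 3≤n 2≤ℓ (from-yes (shortlyConnected? 3≤n))
theorem2p9 (suc (suc (suc (suc (suc (suc (suc n))))))) _ 3≤n 2≤ℓ =
  (threeColouring 3≤n , threeColouring-uses-3 3≤n , threeColouring-connected 3≤n) ,
  λ { _ (c , uses , conn) → ≮⇒≥ (2-colours-insufficient n 3≤n c 2≤ℓ uses conn) }
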